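{- Let $M$ be a 2-semi equivelar map of combinatorial curvature $0$ on the torus or on the Klein bottle, and let $T=[f_1:f_2]$ be its type. Then $T$ (as an unordered pair of face-sequences) belongs to $\{[3^6:3^4.6]$, $[3^6:3^3.4^2]$, $[3^6:3^2.4.3.4]$, $[3^6:3^2.4.12]$, $[3^6:3^2.6^2]$, $[3^4.6:3.6.3.6]$, $[3^3.4^2:3^2.4.3.4]$, $[3^3.4^2:3.4.6.4]$, $[3^3.4^2:4^4]$, $[3^2.4.3.4:3.4.6.4]$, $[3^2.6^2:3^4.6]$, $[3^2.6^2:3.6.3.6]$, $[3.4^2.6:3.4.6.4]$, $[3.4^2.6:3.6.3.6]$, $[3.4.6.4:4.6.12]$, $[3.12^2:3.4.3.12]\}$.
   Context: A map $M$ on a surface $S$ is an embedding of a graph $G$ into $S$ such that (i) the closure of each component of $S\setminus G$ is a closed 2-disk bounded by a $p$-cycle of $G$ ($p\ge 3$), called a $p$-gonal face, and (ii) the non-empty intersection of two distinct faces is either a vertex or an edge. The face-sequence of a vertex $v$ is written $(p_1^{n_1}.p_2^{n_2}\cdots p_k^{n_k})$ if, going around $v$ in cyclic order, there are $n_1$ consecutive $p_1$-gons, then $n_2$ consecutive $p_2$-gons, ..., then $n_k$ consecutive $p_k$-gons incident with $v$ (face-sequences are considered up to cyclic rotation and reversal). The curvature of $v$ is $\phi(v)=1-\frac{1}{2}\sum_i n_i+\sum_i \frac{n_i}{p_i}$; $M$ has combinatorial curvature $0$ if $\phi(v)=0$ for every vertex $v$. A map whose vertices exhibit exactly $k$ distinct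 face-sequences $f_1,\dots,f_k$ is a $k$-semi equivelar map of type $[f_1:f_2:\cdots:f_k]$. -}

module Defs where

open import Data.Nat as ℕ using (ℕ; zero; suc; _≤_; _<_; s≤s; _<?_)
open import Data.Fin as Fin using (Fin; toℕ; fromℕ<)
open import Data.Fin.Properties using (any?) renaming (_≟_ to _≟ᶠ_)
open import Data.List using (List; []; _∷_; _++_; drop; take; reverse; map; length; filter; cartesianProduct; foldr)
open import Data.List.Membership.Propositional using (_∈_)
open import Data.List.Relation.Unary.Any using (Any)
open import Data.Product using (Σ; ∃; ∃-syntax; _×_; _,_)
open import Data.Product.Properties using () 
open import Data.Sum using (_⊎_; inj₁; inj₂)
open import Data.Integer using (+_)
open import Data.Rational using (ℚ; _/_; 0ℚ; 1ℚ; _+_; _-_)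
open import Function.Definitions using (Injective)
open import Relation.Binary.PropositionalEquality using (_≡_; _≢_)
open import Relation.Nullary using (¬_; Dec)
open import Relation.Nullary.Decidable using (_×-dec_; _⊎-dec_)
open import Relation.Unary using (Decidable)

csucc : ∀ {p} → Fin p → Fin p
csucc {suc m} i with suc (toℕ i) <? suc m
... | Relation.Nullary.yes lt = fromℕ< lt
... | Relation.Nullary.no _  = Fin.zero

-- Combinatorial data of a map: vertices Fin nV, faces Fin nF,
-- face f is the cycle  bd f 0, bd f 1, …, bd f (len f - 1)  (closing up).

record PreMap : Set where
  field
    nV  : ℕ
    nF  : ℕ
    len : Fin nF → ℕ
    bd  : (f : Fin nF) → Fin (len f) → Fin nV

module _ (M : PreMap) where
  open PreMap M

  OnFace : Fin nF → Fin nV → Set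
  OnFace f v = ∃[ i ] bd f i ≡ v

  EdgeIn : Fin nF → Fin nV → Fin nV → Set
  EdgeIn f u v = ∃[ i ] ((bd f i ≡ u × bd f (csucc i) ≡ v) ⊎ (bd f i ≡ v × bd f (csucc i) ≡ u))

  IsEdge : Fin nV → Fin nV → Set
  IsEdge u v = ∃[ f ] EdgeIn f u v

  isEdge? : (u v : Fin nV) → Dec (IsEdge u v)
  isEdge? u v = any? λ f → any? λ i →
    ((bd f i ≟ᶠ u) ×-dec (bd f (csucc i) ≟ᶠ v)) ⊎-dec ((bd f i ≟ᶠ v) ×-dec (bd f (csucc i) ≟ᶠ u))

  numEdges : ℕ
  numEdges = length (filter edge? (cartesianProduct (Data.List.allFin nV) (Data.List.allFin nV)))
    where
    edge? : Decidable (λ (p : Fin nV × Fin nV) → (toℕ (Data.Product.proj₁ p) < toℕ (Data.Product.proj₂ p)) × IsEdge (Data.Product.proj₁ p) (Data.Product.proj₂ p))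
    edge? (u , v) = (toℕ u <? toℕ v) ×-dec isEdge? u v

  data Reach (u : Fin nV) : Fin nV → Set where
    here : Reach u u
    step : ∀ {v w} → Reach u v → IsEdge v w → Reach u w

  record FaceCycle (v : Fin nV) : Set where
    field
      k       : ℕ
      k≥3     : 3 ≤ k
      ρ       : Fin k → Fin nF
      ρ-inj   : Injective _≡_ _≡_ ρ
      ρ-on    : ∀ j → OnFace (ρ j) v
      ρ-all   : ∀ f → OnFace f v → ∃[ j ] ρ j ≡ f
      ρ-adj   : ∀ j → ∃[ u ] (EdgeIn (ρ j) v u × EdgeIn (ρ (csucc j)) v u)

  seqOf : ∀ {v} → FaceCycle v → List ℕ
  seqOf c = map (λ j → len (FaceCycle.ρ c j)) (Data.List.allFin (FaceCycle.k c))

  -- M is a map on a closed connected surface (polyhedral map):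
  record IsMap : Set where
    field
      len≥3   : ∀ f → 3 ≤ len f
      bd-inj  : ∀ f → Injective _≡_ _≡_ (bd f)
      edge-2  : ∀ f u v → EdgeIn f u v →
                ∃[ g ] (g ≢ f × EdgeIn g u v × (∀ h → EdgeIn h u v → h ≡ f ⊎ h ≡ g))
      meet    : ∀ f g → f ≢ g → ∀ x y → OnFace f x → OnFace g x → OnFace f y → OnFace g y → x ≢ y →
                EdgeIn f x y × EdgeIn g x y × (∀ z → OnFace f z → OnFace g z → z ≡ x ⊎ z ≡ y)
      -- the faces around every vertex form a single disk (link is a cycle)
      link    : ∀ v → FaceCycle v
      conn    : ∀ u v → Reach u v

  -- Euler characteristic V - E + F = 0 ; together with IsMap this says
  -- M is a map on the torus or the Klein bottle.
  EulerZero : Set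
  EulerZero = nV ℕ.+ nF ≡ numEdges

  -- face-sequence of v (up to rotation/reversal handled by _≈ᶜ_ below)
  HasFS : Fin nV → List ℕ → Set
  HasFS v s = Σ (FaceCycle v) λ c → seqOf c ≡ s

inv : ℕ → ℚ
inv zero    = 0ℚ
inv (suc n) = + 1 / suc n

curvature : List ℕ → ℚ
curvature s = (1ℚ - (+ length s / 2)) + foldr (λ p acc → inv p + acc) 0ℚ s

Rot : List ℕ → List ℕ → Set
Rot xs ys = ∃[ i ] ys ≡ drop i xs ++ take i xs

_≈ᶜ_ : List ℕ → List ℕ → Set
xs ≈ᶜ ys = Rot xs ys ⊎ Rot (reverse xs) ys

module _ (M : PreMap) where
  open PreMap M

  CurvatureZero : Set
  CurvatureZero = ∀ v s → HasFS M v s → curvature s ≡ 0ℚ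

  FSis : Fin nV → List ℕ → Set
  FSis v s = ∃[ t ] (HasFS M v t × t ≈ᶜ s)

  TwoSemiEquivelar : List ℕ → List ℕ → Set
  TwoSemiEquivelar f₁ f₂ =
    ¬ (f₁ ≈ᶜ f₂) × (∃[ v ] FSis v f₁) × (∃[ v ] FSis v f₂) × (∀ v → FSis v f₁ ⊎ FSis v f₂)

allowedTypes : List (List ℕ × List ℕ)
allowedTypes =
    ((3 ∷ 3 ∷ 3 ∷ 3 ∷ 3 ∷ 3 ∷ []) , (3 ∷ 3 ∷ 3 ∷ 3 ∷ 6 ∷ []))
  ∷ ((3 ∷ 3 ∷ 3 ∷ 3 ∷ 3 ∷ 3 ∷ []) , (3 ∷ 3 ∷ 3 ∷ 4 ∷ 4 ∷ []))
  ∷ ((3 ∷ 3 ∷ 3 ∷ 3 ∷ 3 ∷ 3 ∷ []) , (3 ∷ 3 ∷ 4 ∷ 3 ∷ 4 ∷ []))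
  ∷ ((3 ∷ 3 ∷ 3 ∷ 3 ∷ 3 ∷ 3 ∷ []) , (3 ∷ 3 ∷ 4 ∷ 12 ∷ []))
  ∷ ((3 ∷ 3 ∷ 3 ∷ 3 ∷ 3 ∷ 3 ∷ []) , (3 ∷ 3 ∷ 6 ∷ 6 ∷ []))
  ∷ ((3 ∷ 3 ∷ 3 ∷ 3 ∷ 6 ∷ []) , (3 ∷ 6 ∷ 3 ∷ 6 ∷ []))
  ∷ ((3 ∷ 3 ∷ 3 ∷ 4 ∷ 4 ∷ []) , (3 ∷ 3 ∷ 4 ∷ 3 ∷ 4 ∷ []))
  ∷ ((3 ∷ 3 ∷ 3 ∷ 4 ∷ 4 ∷ []) , (3 ∷ 4 ∷ 6 ∷ 4 ∷ []))
  ∷ ((3 ∷ 3 ∷ 3 ∷ 4 ∷ 4 ∷ []) , (4 ∷ 4 ∷ 4 ∷ 4 ∷ []))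
  ∷ ((3 ∷ 3 ∷ 4 ∷ 3 ∷ 4 ∷ []) , (3 ∷ 4 ∷ 6 ∷ 4 ∷ []))
  ∷ ((3 ∷ 3 ∷ 6 ∷ 6 ∷ []) , (3 ∷ 3 ∷ 3 ∷ 3 ∷ 6 ∷ []))
  ∷ ((3 ∷ 3 ∷ 6 ∷ 6 ∷ []) , (3 ∷ 6 ∷ 3 ∷ 6 ∷ []))
  ∷ ((3 ∷ 4 ∷ 4 ∷ 6 ∷ []) , (3 ∷ 4 ∷ 6 ∷ 4 ∷ []))
  ∷ ((3 ∷ 4 ∷ 4 ∷ 6 ∷ []) , (3 ∷ 6 ∷ 3 ∷ 6 ∷ []))
  ∷ ((3 ∷ 4 ∷ 6 ∷ 4 ∷ []) , (4 ∷ 6 ∷ 12 ∷ []))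
  ∷ ((3 ∷ 12 ∷ 12 ∷ []) , (3 ∷ 4 ∷ 3 ∷ 12 ∷ []))
  ∷ []

TypeAllowed : List ℕ → List ℕ → Set
TypeAllowed f₁ f₂ = Any (λ (a , b) → (f₁ ≈ᶜ a × f₂ ≈ᶜ b) ⊎ (f₁ ≈ᶜ b × f₂ ≈ᶜ a)) allowedTypes

{-# OPTIONS --safe #-}
module Submission where

-- A vertex of curvature zero has one of 21 face-sequences, since 1/p₁ + … + 1/pₖ = k/2 − 1 bounds k
-- and every pᵢ. Label each flag (v, edge vu, face f) by the sizes of the faces met when going around v
-- from f, away from vu; the labels range over the rotations and reflections of f₁ and f₂. An edge
-- carries the pair of labels seen from its two ends, on the same side. Such a pair can be discarded as
-- soon as the pairs around an adjacent triangle or square cannot be completed. By connectedness some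
-- edge joins the two types, and for every pair of types outside the list a few rounds of discarding
-- leave no pair for that edge.

open import Defs
open import Data.Nat using (ℕ)
open import Data.List using (List)
open import Data.Nat.Base
open import Data.Nat.Properties
open import Data.Nat.ListAction using (product)
open import Data.Nat.Tactic.RingSolver using (solve-∀)
open import Data.Fin.Base as Fin using (Fin; toℕ; fromℕ; inject₁)
open import Data.Fin.Properties as Fin using (toℕ-injective; toℕ-fromℕ<; toℕ-inject₁; toℕ-fromℕ; toℕ<n; toℕ≤pred[n])
import Data.Integer.Base as ℤ
import Data.Integer.Properties as ℤ
import Data.Integer.Tactic.RingSolver as ℤ
import Data.Rational.Base as ℚ
import Data.Rational.Properties as ℚ
open import Data.Rational.Base using (ℚ; 0ℚ; 1ℚ; toℚᵘ)
open import Data.Rational.Unnormalised.Base as ℚᵘ using (ℚᵘ; mkℚᵘ; 0ℚᵘ; 1ℚᵘ; ↥_; ↧_; ↧ₙ_; _≃_)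
import Data.Rational.Unnormalised.Properties as ℚᵘ
open import Data.List.Base hiding (product; head; find; lookup; List)
open import Data.List.Properties using (≡-dec; unfold-reverse; reverse-involutive; reverse-map; reverse-injective; map-++; ++-assoc; ++-identityʳ; map-tabulate; take++drop≡id; length-tabulate; length-map)
open import Data.List.Membership.Propositional using (_∈_; find; lose)
open import Data.List.Membership.Propositional.Properties
import Data.List.Membership.DecPropositional as DecMembership
open import Data.List.Relation.Unary.All as All using (All; []; _∷_)
open import Data.List.Relation.Unary.All.Properties using (¬Any⇒All¬)
open import Data.List.Relation.Unary.Any as Any using (Any; here; there)
open import Data.List.Relation.Unary.AllPairs using (_∷_)
open import Data.List.Relation.Unary.Unique.Propositional using (Unique)
import Data.List.Relation.Unary.Unique.Propositional.Properties as Unique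
open import Data.List.Relation.Binary.Permutation.Propositional using (_↭_; ↭⇒↭ₛ; ↭-sym; prep)
open import Data.List.Relation.Binary.Permutation.Propositional.Properties using (↭-reverse; ++-comm; ∈-resp-↭; ↭-length)
import Data.List.Relation.Binary.Permutation.Setoid.Properties as Permutationₛ
open import Data.Product.Base using (_×_; _,_; proj₁; proj₂; ∃-syntax; Σ)
open import Data.Product.Properties using () renaming (≡-dec to ×-≡-dec)
open import Data.Sum.Base using (_⊎_; inj₁; inj₂; [_,_]′)
open import Function.Base using (_∘_; case_of_; id)
open import Function.Definitions using (Injective)
open import Relation.Binary.PropositionalEquality hiding ([_])
open import Relation.Nullary
open import Relation.Nullary.Decidable using (from-yes; map′; ¬?; _→-dec_; _×-dec_; _⊎-dec_)
open import Relation.Unary using (Decidable)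

-- Sequences of curvature zero

-- 1/p₁ + … + 1/pₖ = numer s / product s
numer : List ℕ → ℕ
numer []      = 0
numer (p ∷ s) = product s + p * numer s

Flat : List ℕ → Set
Flat s = 2 * product s + 2 * numer s ≡ length s * product s

inverses : List ℕ → ℚ
inverses = foldr (λ p acc → inv p ℚ.+ acc) 0ℚ

-- Unnormalised addition cancels no common factors, so for nonzero entries the numerator and
-- denominator are exactly `numer s` and `product s`. The zero clause matches `inv zero`.
fraction : List ℕ → ℚᵘ
fraction []          = 0ℚᵘ
fraction (zero ∷ s)  = fraction s
fraction (suc n ∷ s) = mkℚᵘ (ℤ.+ 1) n ℚᵘ.+ fraction s

inverses≃fraction : ∀ s → toℚᵘ (inverses s) ≃ fraction s
inverses≃fraction []          = ℚᵘ.≃-refl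
inverses≃fraction (zero ∷ s)  = ℚᵘ.≃-trans (ℚᵘ.≃-reflexive (cong toℚᵘ (ℚ.+-identityˡ _))) (inverses≃fraction s)
inverses≃fraction (suc n ∷ s) = ℚᵘ.≃-trans (ℚ.toℚᵘ-homo-+ (inv (suc n)) (inverses s))
  (ℚᵘ.+-cong (ℚ.toℚᵘ-fromℚᵘ (mkℚᵘ (ℤ.+ 1) n)) (inverses≃fraction s))

↥-+ : ∀ p q → ↥ (p ℚᵘ.+ q) ≡ ↥ p ℤ.* ↧ q ℤ.+ ↥ q ℤ.* ↧ p
↥-+ record{} record{} = refl

↧ₙ-+ : ∀ p q → ↧ₙ (p ℚᵘ.+ q) ≡ ↧ₙ p * ↧ₙ q
↧ₙ-+ record{} record{} = refl

↧ₙ-fraction : ∀ {s} → All (3 ≤_) s → ↧ₙ (fraction s) ≡ product s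
↧ₙ-fraction []                  = refl
↧ₙ-fraction {suc n ∷ s} (_ ∷ a) = trans (↧ₙ-+ (mkℚᵘ (ℤ.+ 1) n) (fraction s)) (cong (suc n *_) (↧ₙ-fraction a))

↥-fraction : ∀ {s} → All (3 ≤_) s → ↥ (fraction s) ≡ ℤ.+ numer s
↥-fraction []                  = refl
↥-fraction {suc n ∷ s} (_ ∷ a) = begin
  ↥ (mkℚᵘ (ℤ.+ 1) n ℚᵘ.+ fraction s)                            ≡⟨ ↥-+ (mkℚᵘ (ℤ.+ 1) n) (fraction s) ⟩
  ℤ.+ 1 ℤ.* ↧ (fraction s) ℤ.+ ↥ (fraction s) ℤ.* ℤ.+ suc n     ≡⟨ cong₂ (λ d m → ℤ.+ 1 ℤ.* d ℤ.+ m ℤ.* ℤ.+ suc n) (cong ℤ.+_ (↧ₙ-fraction a)) (↥-fraction a) ⟩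
  ℤ.+ 1 ℤ.* ℤ.+ product s ℤ.+ ℤ.+ numer s ℤ.* ℤ.+ suc n         ≡⟨ cong₂ ℤ._+_ (ℤ.*-identityˡ (ℤ.+ product s)) (sym (ℤ.pos-* (numer s) (suc n))) ⟩
  ℤ.+ (product s + numer s * suc n)                             ≡⟨ cong (λ m → ℤ.+ (product s + m)) (*-comm (numer s) (suc n)) ⟩
  ℤ.+ (product s + suc n * numer s)                             ∎
  where open ≡-Reasoning

-- With N/D the sum of reciprocals, the unnormalised curvature has numerator (2 - k) D + 2 N, which
-- must vanish.
curvature≡0⇒Flat : ∀ {s} → All (3 ≤_) s → curvature s ≡ 0ℚ → Flat s
curvature≡0⇒Flat {s} a eq = sym (ℤ.+-injective (begin
  ℤ.+ (k * D)                                                ≡⟨ ℤ.pos-* k D ⟩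
  ℤ.+ k ℤ.* ℤ.+ D                                            ≡⟨ ℤ.+-identityʳ _ ⟨
  ℤ.+ k ℤ.* ℤ.+ D ℤ.+ ℤ.+ 0                                  ≡⟨ cong (λ z → ℤ.+ k ℤ.* ℤ.+ D ℤ.+ z) num≡0 ⟨
  ℤ.+ k ℤ.* ℤ.+ D ℤ.+ ((ℤ.+ 2 ℤ.+ ℤ.- (ℤ.+ k)) ℤ.* ℤ.+ D ℤ.+ ℤ.+ N ℤ.* ℤ.+ 2) ≡⟨ cancel (ℤ.+ k) (ℤ.+ D) (ℤ.+ N) ⟩
  ℤ.+ 2 ℤ.* ℤ.+ D ℤ.+ ℤ.+ 2 ℤ.* ℤ.+ N                        ≡⟨ cong₂ ℤ._+_ (ℤ.pos-* 2 D) (ℤ.pos-* 2 N) ⟨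
  ℤ.+ (2 * D + 2 * N)                                        ∎))
  where
  open ≡-Reasoning
  k = length s
  D = product s
  N = numer s
  half = mkℚᵘ (ℤ.+ k) 1
  head = 1ℚᵘ ℚᵘ.+ ℚᵘ.- half

  cancel : ∀ k D N → k ℤ.* D ℤ.+ ((ℤ.+ 2 ℤ.+ ℤ.- k) ℤ.* D ℤ.+ N ℤ.* ℤ.+ 2) ≡ ℤ.+ 2 ℤ.* D ℤ.+ ℤ.+ 2 ℤ.* N
  cancel = ℤ.solve-∀

  head≃ : toℚᵘ (1ℚ ℚ.- (ℤ.+ k ℚ./ 2)) ≃ head
  head≃ = ℚᵘ.≃-trans (ℚ.toℚᵘ-homo-+ 1ℚ (ℚ.- (ℤ.+ k ℚ./ 2)))
    (ℚᵘ.+-congʳ 1ℚᵘ (ℚᵘ.≃-trans (ℚ.toℚᵘ-homo‿- (ℤ.+ k ℚ./ 2)) (ℚᵘ.-‿cong (ℚ.toℚᵘ-fromℚᵘ half))))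

  curvature≃ : head ℚᵘ.+ fraction s ≃ 0ℚᵘ
  curvature≃ = ℚᵘ.≃-trans (ℚᵘ.≃-sym (ℚᵘ.+-cong head≃ (inverses≃fraction s)))
    (ℚᵘ.≃-trans (ℚᵘ.≃-sym (ℚ.toℚᵘ-homo-+ (1ℚ ℚ.- (ℤ.+ k ℚ./ 2)) (inverses s))) (ℚ.toℚᵘ-cong eq))

  num≡0 : (ℤ.+ 2 ℤ.+ ℤ.- (ℤ.+ k)) ℤ.* ℤ.+ D ℤ.+ ℤ.+ N ℤ.* ℤ.+ 2 ≡ ℤ.+ 0
  num≡0 = begin
    (ℤ.+ 2 ℤ.+ ℤ.- (ℤ.+ k)) ℤ.* ℤ.+ D ℤ.+ ℤ.+ N ℤ.* ℤ.+ 2                     ≡⟨ cong (λ x → (ℤ.+ 2 ℤ.+ x) ℤ.* ℤ.+ D ℤ.+ ℤ.+ N ℤ.* ℤ.+ 2) (ℤ.*-identityʳ (ℤ.- (ℤ.+ k))) ⟨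
    ↥ head ℤ.* ℤ.+ D ℤ.+ ℤ.+ N ℤ.* ↧ head                                   ≡⟨ cong₂ (λ d m → ↥ head ℤ.* ℤ.+ d ℤ.+ m ℤ.* ↧ head) (↧ₙ-fraction a) (↥-fraction a) ⟨
    ↥ head ℤ.* ↧ (fraction s) ℤ.+ ↥ (fraction s) ℤ.* ↧ head                 ≡⟨ ↥-+ head (fraction s) ⟨
    ↥ (head ℚᵘ.+ fraction s)                                                ≡⟨ ℚᵘ.p≃0⇒↥p≡0 (head ℚᵘ.+ fraction s) curvature≃ ⟩
    ℤ.+ 0                                                                   ∎

-- Isolating one entry of a flat sequence

product-─ : ∀ {p s} (i : p ∈ s) → product s ≡ p * product (s Any.─ i)
product-─ (here refl) = refl
product-─ {p} {x ∷ s} (there i) rewrite product-─ i = swap x p (product (s Any.─ i))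
  where
  swap : ∀ x p d → x * (p * d) ≡ p * (x * d)
  swap = solve-∀

-- `numer` is symmetric in the entries, so any entry can play the role of the head in its
-- recurrence.
numer-─ : ∀ {p s} (i : p ∈ s) → numer s ≡ product (s Any.─ i) + p * numer (s Any.─ i)
numer-─ (here refl) = refl
numer-─ {p} {x ∷ s} (there i) rewrite product-─ i | numer-─ i =
  swap x p (product (s Any.─ i)) (numer (s Any.─ i))
  where
  swap : ∀ x p d n → p * d + x * (d + p * n) ≡ x * d + p * (d + x * n)
  swap = solve-∀

length-─ : ∀ {p : ℕ} {s} (i : p ∈ s) → length s ≡ suc (length (s Any.─ i))
length-─ (here refl)           = refl
length-─ {s = _ ∷ _} (there i) = cong suc (length-─ i)

All-─ : ∀ {P : ℕ → Set} {p s} (i : p ∈ s) → All P s → All P (s Any.─ i)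
All-─ (here refl) (_ ∷ a) = a
All-─ (there i)   (x ∷ a) = x ∷ All-─ i a

product>0 : ∀ {s} → All (3 ≤_) s → 0 < product s
product>0 []      = ≤-refl
product>0 (p ∷ a) = *-mono-≤ (≤-trans (s≤s z≤n) p) (product>0 a)

-- Every reciprocal is at most 1/3, and denominators are cleared.
numer-bound : ∀ {s} → All (3 ≤_) s → 3 * numer s ≤ length s * product s
numer-bound [] = ≤-refl
numer-bound {p ∷ s} (3≤p ∷ a) = begin
  3 * (product s + p * numer s)                     ≡⟨ distrib p (product s) (numer s) ⟩
  3 * product s + p * (3 * numer s)                 ≤⟨ +-mono-≤ (*-monoˡ-≤ (product s) 3≤p) (*-monoʳ-≤ p (numer-bound a)) ⟩
  p * product s + p * (length s * product s)        ≡⟨ cong (p * product s +_) (swap p (length s) (product s)) ⟩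
  p * product s + length s * (p * product s)        ∎
  where
  open ≤-Reasoning
  distrib : ∀ p d n → 3 * (d + p * n) ≡ 3 * d + p * (3 * n)
  distrib = solve-∀
  swap : ∀ p k d → p * (k * d) ≡ k * (p * d)
  swap = solve-∀

-- The large entry contributes at most 1/t and each other entry at most 1/3.
numer-bound-large : ∀ {s t p} → All (3 ≤_) s → (i : p ∈ s) → t ≤ p →
                    (3 * t) * numer s ≤ (3 + t * length (s Any.─ i)) * product s
numer-bound-large {s} {t} {p} a i t≤p rewrite product-─ i | numer-─ i = begin
  (3 * t) * (d + p * n)                    ≡⟨ distrib t p d n ⟩
  t * (3 * d) + (t * p) * (3 * n)          ≤⟨ +-mono-≤ (*-monoˡ-≤ (3 * d) t≤p) (*-monoʳ-≤ (t * p) (numer-bound (All-─ i a))) ⟩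
  p * (3 * d) + (t * p) * (k * d)          ≡⟨ collect t p d k ⟩
  (3 + t * k) * (p * d)                    ∎
  where
  open ≤-Reasoning
  d = product (s Any.─ i)
  n = numer (s Any.─ i)
  k = length (s Any.─ i)
  distrib : ∀ t p d n → (3 * t) * (d + p * n) ≡ t * (3 * d) + (t * p) * (3 * n)
  distrib = solve-∀
  collect : ∀ t p d k → p * (3 * d) + (t * p) * (k * d) ≡ (3 + t * k) * (p * d)
  collect = solve-∀

-- With n/d the sum of the other reciprocals, flatness reads 1/p + n/d = c/2; this is that equation
-- multiplied by 2 p d.
Flat-─ : ∀ {s p c} (i : p ∈ s) → length s ≡ 2 + c → Flat s →
         2 * product (s Any.─ i) + p * (2 * numer (s Any.─ i)) ≡ p * (c * product (s Any.─ i))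
Flat-─ {s} {p} {c} i len flat rewrite len | product-─ i | numer-─ i =
  +-cancelˡ-≡ (2 * (p * d)) _ _ (trans (expand p d n) (trans flat (collect p c d)))
  where
  d = product (s Any.─ i)
  n = numer (s Any.─ i)
  expand : ∀ p d n → 2 * (p * d) + (2 * d + p * (2 * n)) ≡ 2 * (p * d) + 2 * (d + p * n)
  expand = solve-∀
  collect : ∀ p c d → (2 + c) * (p * d) ≡ 2 * (p * d) + p * (c * d)
  collect = solve-∀

-- 1/p is positive, so the other reciprocals fall strictly short of c/2, as `gap` requires.
Flat⇒rest< : ∀ {s p c} (i : p ∈ s) → All (3 ≤_) s → length s ≡ 2 + c → Flat s →
             2 * numer (s Any.─ i) < c * product (s Any.─ i)
Flat⇒rest< {s} {p} {c} i a len flat = *-cancelˡ-< p _ _ (begin-strict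
  p * (2 * numer (s Any.─ i))                                  <⟨ m<n+m _ (*-mono-≤ {1} {2} (s≤s z≤n) (product>0 (All-─ i a))) ⟩
  2 * product (s Any.─ i) + p * (2 * numer (s Any.─ i))        ≡⟨ Flat-─ i len flat ⟩
  p * (c * product (s Any.─ i))                                ∎)
  where open ≤-Reasoning

-- The rest of the sum of reciprocals is at most B/A, whereas it falls short of c/2 by exactly 1/p.
entry-bound : ∀ {s p c} A B e (i : p ∈ s) → All (3 ≤_) s → length s ≡ 2 + c → Flat s →
              A * numer (s Any.─ i) ≤ B * product (s Any.─ i) → c * A ≡ 2 * B + e → e * p ≤ 2 * A
entry-bound {s} {p} {c} A B e i a len flat AN≤BD cA = *-cancelʳ-≤ _ _ d {{>-nonZero (product>0 (All-─ i a))}}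
  (+-cancelˡ-≤ (2 * p * (B * d)) _ _ (begin
    2 * p * (B * d) + e * p * d            ≡⟨ collect p B e d ⟩
    p * ((2 * B + e) * d)                  ≡⟨ cong (λ x → p * (x * d)) cA ⟨
    p * (c * A * d)                        ≡⟨ swap p c A d ⟩
    A * (p * (c * d))                      ≡⟨ cong (A *_) (Flat-─ i len flat) ⟨
    A * (2 * d + p * (2 * n))              ≡⟨ distrib A d p n ⟩
    2 * p * (A * n) + 2 * A * d            ≤⟨ +-monoˡ-≤ (2 * A * d) (*-monoʳ-≤ (2 * p) AN≤BD) ⟩
    2 * p * (B * d) + 2 * A * d            ∎))
  where
  open ≤-Reasoning
  d = product (s Any.─ i)
  n = numer (s Any.─ i)
  collect : ∀ p B e d → 2 * p * (B * d) + e * p * d ≡ p * ((2 * B + e) * d)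
  collect = solve-∀
  swap : ∀ p c A d → p * (c * A * d) ≡ A * (p * (c * d))
  swap = solve-∀
  distrib : ∀ A d p n → A * (2 * d + p * (2 * n)) ≡ 2 * p * (A * n) + 2 * A * d
  distrib = solve-∀

-- The reciprocals sum to k/2 - 1 and to at most k/3.
Flat⇒length≤6 : ∀ {s} → All (3 ≤_) s → Flat s → length s ≤ 6
Flat⇒length≤6 {s} a flat = *-cancelʳ-≤ _ _ d {{>-nonZero (product>0 a)}} (+-cancelˡ-≤ (2 * (k * d)) _ _ (begin
  2 * (k * d) + k * d      ≡⟨ collect (k * d) ⟩
  3 * (k * d)              ≡⟨ cong (3 *_) flat ⟨
  3 * (2 * d + 2 * n)      ≡⟨ distrib d n ⟩
  2 * (3 * n) + 6 * d      ≤⟨ +-monoˡ-≤ (6 * d) (*-monoʳ-≤ 2 (numer-bound a)) ⟩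
  2 * (k * d) + 6 * d      ∎))
  where
  open ≤-Reasoning
  k = length s
  d = product s
  n = numer s
  collect : ∀ x → 2 * x + x ≡ 3 * x
  collect = solve-∀
  distrib : ∀ d n → 3 * (2 * d + 2 * n) ≡ 2 * (3 * n) + 6 * d
  distrib = solve-∀

-- Enumeration of sequences with bounded entries

words : ∀ {A : Set} → ℕ → List A → List (List A)
words zero    xs = [] ∷ []
words (suc n) xs = cartesianProductWith _∷_ xs (words n xs)

∈-words : ∀ {A : Set} {xs s : List A} → All (_∈ xs) s → s ∈ words (length s) xs
∈-words []      = here refl
∈-words (x ∷ a) = ∈-cartesianProductWith⁺ _∷_ x (∈-words a)

sizes : ℕ → List ℕ
sizes n = map (3 +_) (upTo n)

∈-sizes : ∀ {n p} → 3 ≤ p → p < 3 + n → p ∈ sizes n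
∈-sizes (s≤s (s≤s (s≤s z≤n))) (s<s (s<s (s<s p<n))) = ∈-map⁺ (3 +_) (∈-upTo⁺ p<n)

∈-words-sizes : ∀ {n s} → All (3 ≤_) s → All (_< 3 + n) s → s ∈ words (length s) (sizes n)
∈-words-sizes a b = ∈-words (All.zipWith (λ (x , y) → ∈-sizes x y) (a , b))

-- Among n + 1 sizes ≥ 3 whose reciprocals sum to less than c/2, that sum is at most
-- (3 + t n)/(3 t) = 1/t + n/3: either some size is ≥ t, or there are finitely many cases.
gap : ∀ n t c {s} → 3 ≤ t →
      All (λ r → 2 * numer r < c * product r → (3 * t) * numer r ≤ (3 + t * n) * product r)
          (words (suc n) (sizes (t ∸ 3))) →
      All (3 ≤_) s → length s ≡ suc n → 2 * numer s < c * product s →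
      (3 * t) * numer s ≤ (3 + t * n) * product s
gap n t c {s} 3≤t table a len small with Any.any? (t ≤?_) s
... | yes large = let (p , i , t≤p) = find large in
  subst (λ m → (3 * t) * numer s ≤ (3 + t * m) * product s) (suc-injective (trans (sym (length-─ i)) len))
    (numer-bound-large a i t≤p)
... | no ¬large = All.lookup table
  (subst (λ m → s ∈ words m (sizes (t ∸ 3))) len (∈-words-sizes a (All.map below (¬Any⇒All¬ s ¬large)))) small
  where
  below : ∀ {p} → ¬ (t ≤ p) → p < 3 + (t ∸ 3)
  below t≰p = subst (_ <_) (sym (m+[n∸m]≡n 3≤t)) (≰⇒> t≰p)

Gap? : ∀ n t c → Dec (All (λ r → 2 * numer r < c * product r → (3 * t) * numer r ≤ (3 + t * n) * product r)
                          (words (suc n) (sizes (t ∸ 3))))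
Gap? n t c = All.all? (λ r → (2 * numer r <? c * product r) →-dec ((3 * t) * numer r ≤? (3 + t * n) * product r)) _

-- Sizes around a vertex of degree k are less than 3 + bound k; the extreme cases are
-- 3.7.42, 3.3.4.12, 3.3.3.3.6 and 3.3.3.3.3.3.
bound : ℕ → ℕ
bound 3 = 40
bound 4 = 10
bound 5 = 4
bound 6 = 1
bound _ = 0

Flat⇒<bound : ∀ {s} → All (3 ≤_) s → 3 ≤ length s → Flat s → All (_< 3 + bound (length s)) s
Flat⇒<bound {s} a 3≤k flat = All.tabulate (entry (length s) refl 3≤k (Flat⇒length≤6 a flat))
  where
  rest : ∀ {p} (i : p ∈ s) {n} → length s ≡ suc n → length (s Any.─ i) ≡ n
  rest i len = suc-injective (trans (sym (length-─ i)) len)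

  entry : ∀ k → length s ≡ k → 3 ≤ k → k ≤ 6 → ∀ {p} → p ∈ s → p < 3 + bound k
  -- Two reciprocals with sum below 1/2 have sum at most 1/7 + 1/3 = 10/21, so 1/p is at least 1/42.
  entry 3 len _ _ {p} i = s≤s (subst (_≤ 42) (*-identityˡ p) (entry-bound 21 10 1 i a len flat
    (gap 1 7 1 (m≤m+n 3 4) (from-yes (Gap? 1 7 1)) (All-─ i a) (rest i len) (Flat⇒rest< i a len flat)) refl))
  -- Three reciprocals with sum below 1 have sum at most 1/4 + 2/3 = 11/12, so 1/p is at least 1/12.
  entry 4 len _ _ i = s≤s (*-cancelˡ-≤ 2 (entry-bound 12 11 2 i a len flat
    (gap 2 4 2 (m≤m+n 3 1) (from-yes (Gap? 2 4 2)) (All-─ i a) (rest i len) (Flat⇒rest< i a len flat)) refl))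
  -- From degree 5 on, 1/3 per entry is sharp enough: 3/2 - 4/3 = 1/6 here, and 2 - 5/3 = 1/3 in
  -- degree 6.
  entry 5 len _ _ {p} i = s≤s (subst (_≤ 6) (*-identityˡ p) (entry-bound 3 4 1 i a len flat
    (subst (λ m → 3 * numer (s Any.─ i) ≤ m * product (s Any.─ i)) (rest i len) (numer-bound (All-─ i a))) refl))
  entry 6 len _ _ i = s≤s (*-cancelˡ-≤ 2 (entry-bound 3 5 2 i a len flat
    (subst (λ m → 3 * numer (s Any.─ i) ≤ m * product (s Any.─ i)) (rest i len) (numer-bound (All-─ i a))) refl))
  entry (suc (suc (suc (suc (suc (suc (suc _))))))) _ _ (s≤s (s≤s (s≤s (s≤s (s≤s (s≤s ())))))) _
  entry 1 _ (s≤s ()) _ _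
  entry 2 _ (s≤s (s≤s ())) _ _

-- Face-sequences up to rotation and reversal

Label : Set
Label = List ℕ

_≟ₗ_ : (ℓ m : Label) → Dec (ℓ ≡ m)
_≟ₗ_ = ≡-dec _≟_

open DecMembership _≟ₗ_ using (_∈?_)

rotations : List ℕ → List Label
rotations s = map (λ i → drop i s ++ take i s) (upTo (length s))

orbit : List ℕ → List Label
orbit s = deduplicate _≟ₗ_ (rotations s ++ rotations (reverse s))

-- One representative per dihedral class. Arithmetic alone also admits sequences such as 3.7.42;
-- their pairings with other types are excluded by the later search.
types : List Label
types =
    (3 ∷ 3 ∷ 3 ∷ 3 ∷ 3 ∷ 3 ∷ [])
  ∷ (3 ∷ 3 ∷ 3 ∷ 3 ∷ 6 ∷ [])
  ∷ (3 ∷ 3 ∷ 3 ∷ 4 ∷ 4 ∷ [])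
  ∷ (3 ∷ 3 ∷ 4 ∷ 3 ∷ 4 ∷ [])
  ∷ (4 ∷ 4 ∷ 4 ∷ 4 ∷ [])
  ∷ (3 ∷ 6 ∷ 3 ∷ 6 ∷ [])
  ∷ (3 ∷ 3 ∷ 6 ∷ 6 ∷ [])
  ∷ (3 ∷ 4 ∷ 4 ∷ 6 ∷ [])
  ∷ (3 ∷ 4 ∷ 6 ∷ 4 ∷ [])
  ∷ (3 ∷ 3 ∷ 4 ∷ 12 ∷ [])
  ∷ (3 ∷ 4 ∷ 3 ∷ 12 ∷ [])
  ∷ (6 ∷ 6 ∷ 6 ∷ [])
  ∷ (3 ∷ 7 ∷ 42 ∷ [])
  ∷ (3 ∷ 8 ∷ 24 ∷ [])
  ∷ (3 ∷ 9 ∷ 18 ∷ [])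
  ∷ (3 ∷ 10 ∷ 15 ∷ [])
  ∷ (3 ∷ 12 ∷ 12 ∷ [])
  ∷ (4 ∷ 5 ∷ 20 ∷ [])
  ∷ (4 ∷ 6 ∷ 12 ∷ [])
  ∷ (4 ∷ 8 ∷ 8 ∷ [])
  ∷ (5 ∷ 5 ∷ 10 ∷ [])
  ∷ []

Typed : List ℕ → Set
Typed s = Any (λ c → s ∈ orbit c) types

FlatTyped? : ∀ n b → Dec (All (λ s → Flat s → Typed s) (words n (sizes b)))
FlatTyped? n b = All.all? (λ s → (2 * product s + 2 * numer s ≟ length s * product s) →-dec Any.any? (λ c → s ∈? orbit c) types) _

-- The bounds on length and entries leave finitely many words, all checked by evaluation.
Flat⇒Typed : ∀ {s} → All (3 ≤_) s → 3 ≤ length s → Flat s → Typed s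
Flat⇒Typed {s} a 3≤k flat = search (length s) refl 3≤k (Flat⇒length≤6 a flat)
  where
  lookup : ∀ {k} → length s ≡ k → All (λ s → Flat s → Typed s) (words k (sizes (bound k))) → Typed s
  lookup refl table = All.lookup table (∈-words-sizes a (Flat⇒<bound a 3≤k flat)) flat

  search : ∀ k → length s ≡ k → 3 ≤ k → k ≤ 6 → Typed s
  search 3 len _ _ = lookup len (from-yes (FlatTyped? 3 40))
  search 4 len _ _ = lookup len (from-yes (FlatTyped? 4 10))
  search 5 len _ _ = lookup len (from-yes (FlatTyped? 5 4))
  search 6 len _ _ = lookup len (from-yes (FlatTyped? 6 1))
  search (suc (suc (suc (suc (suc (suc (suc _))))))) _ _ (s≤s (s≤s (s≤s (s≤s (s≤s (s≤s ()))))))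
  search 1 _ (s≤s ()) _
  search 2 _ (s≤s (s≤s ())) _

-- On labels of flags, turn exchanges the two edges of the face at the vertex, while reverse
-- exchanges the two faces on the edge.
turn : ∀ {A : Set} → List A → List A
turn []       = []
turn (x ∷ xs) = x ∷ reverse xs

record Dihedral (S : List Label) : Set where
  field
    turn-closed    : ∀ {ℓ} → ℓ ∈ S → turn ℓ ∈ S
    reverse-closed : ∀ {ℓ} → ℓ ∈ S → reverse ℓ ∈ S

  -- `reverse` after `turn` moves the head to the end, so the two reflections generate all
  -- rotations.
  rotate-closed : ∀ xs ys → xs ++ ys ∈ S → ys ++ xs ∈ S
  rotate-closed []       ys h = subst (_∈ S) (sym (++-identityʳ ys)) h
  rotate-closed (x ∷ xs) ys h = subst (_∈ S) (++-assoc ys [ x ] xs)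
    (rotate-closed xs (ys ∷ʳ x) (subst (_∈ S) eq (reverse-closed (turn-closed h))))
    where
    open ≡-Reasoning
    eq : reverse (x ∷ reverse (xs ++ ys)) ≡ xs ++ (ys ∷ʳ x)
    eq = begin
      reverse (x ∷ reverse (xs ++ ys))        ≡⟨ unfold-reverse x (reverse (xs ++ ys)) ⟩
      reverse (reverse (xs ++ ys)) ∷ʳ x       ≡⟨ cong (_∷ʳ x) (reverse-involutive (xs ++ ys)) ⟩
      (xs ++ ys) ∷ʳ x                         ≡⟨ ++-assoc xs ys [ x ] ⟩
      xs ++ (ys ∷ʳ x)                         ∎

  Rot-closed : ∀ {s t} → Rot s t → s ∈ S → t ∈ S
  Rot-closed {s} (i , refl) h = rotate-closed (take i s) (drop i s) (subst (_∈ S) (sym (take++drop≡id i s)) h)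

  Rot-closed⁻ : ∀ {s t} → Rot s t → t ∈ S → s ∈ S
  Rot-closed⁻ {s} (i , refl) h = subst (_∈ S) (take++drop≡id i s) (rotate-closed (drop i s) (take i s) h)

  ≈ᶜ-closed : ∀ {s t} → s ≈ᶜ t → s ∈ S → t ∈ S
  ≈ᶜ-closed (inj₁ r) h = Rot-closed r h
  ≈ᶜ-closed (inj₂ r) h = Rot-closed r (reverse-closed h)

  ≈ᶜ-closed⁻ : ∀ {s t} → s ≈ᶜ t → t ∈ S → s ∈ S
  ≈ᶜ-closed⁻     (inj₁ r) h = Rot-closed⁻ r h
  ≈ᶜ-closed⁻ {s} (inj₂ r) h = subst (_∈ S) (reverse-involutive s) (reverse-closed (Rot-closed⁻ r h))

open Dihedral

Dihedral-++ : ∀ {S T} → Dihedral S → Dihedral T → Dihedral (S ++ T)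
Dihedral-++ {S} {T} dS dT = record
  { turn-closed    = λ h → [ ∈-++⁺ˡ ∘ turn-closed dS , ∈-++⁺ʳ S ∘ turn-closed dT ]′ (∈-++⁻ S h)
  ; reverse-closed = λ h → [ ∈-++⁺ˡ ∘ reverse-closed dS , ∈-++⁺ʳ S ∘ reverse-closed dT ]′ (∈-++⁻ S h)
  }

-- Polygons

toℕ-csucc : ∀ {m} (i : Fin (suc m)) → toℕ (csucc i) ≡ suc (toℕ i) ⊎ (toℕ (csucc i) ≡ 0 × toℕ i ≡ m)
toℕ-csucc {m} i with suc (toℕ i) <? suc m
... | yes i<m = inj₁ (toℕ-fromℕ< i<m)
... | no  i≮m = inj₂ (refl , ≤-antisym (toℕ≤pred[n] i) (≮⇒≥ (i≮m ∘ s≤s)))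

csucc-injective : ∀ {p} → Injective _≡_ _≡_ (csucc {p})
csucc-injective {suc m} {i} {j} eq with toℕ-csucc i | toℕ-csucc j
... | inj₁ a       | inj₁ b       = toℕ-injective (suc-injective (trans (sym a) (trans (cong toℕ eq) b)))
... | inj₁ a       | inj₂ (b , _) = case trans (sym a) (trans (cong toℕ eq) b) of λ ()
... | inj₂ (a , _) | inj₁ b       = case trans (sym b) (trans (cong toℕ (sym eq)) a) of λ ()
... | inj₂ (_ , a) | inj₂ (_ , b) = toℕ-injective (trans a (sym b))

csucc-inject₁ : ∀ {m} (j : Fin m) → csucc (inject₁ j) ≡ Fin.suc j
csucc-inject₁ j with toℕ-csucc (inject₁ j)
... | inj₁ a       = toℕ-injective (trans a (cong suc (toℕ-inject₁ j)))
... | inj₂ (_ , b) = contradiction (trans (sym (toℕ-inject₁ j)) b) (<⇒≢ (toℕ<n j))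

csucc-fromℕ : ∀ m → csucc (fromℕ m) ≡ Fin.zero
csucc-fromℕ m with toℕ-csucc (fromℕ m)
... | inj₁ a       = contradiction (trans a (cong suc (toℕ-fromℕ m))) (<⇒≢ (toℕ<n (csucc (fromℕ m))))
... | inj₂ (a , _) = toℕ-injective a

csucc-≢ : ∀ {p} → 2 ≤ p → (i : Fin p) → csucc i ≢ i
csucc-≢ {suc m} (s≤s 1≤m) i eq with toℕ-csucc i
... | inj₁ a       = 1+n≢n (trans (sym a) (cong toℕ eq))
... | inj₂ (a , b) = <⇒≢ 1≤m (trans (sym a) (trans (cong toℕ eq) b))

csucc²-≢ : ∀ {p} → 3 ≤ p → (i : Fin p) → csucc (csucc i) ≢ i
csucc²-≢ {suc m} (s≤s 2≤m) i eq with toℕ-csucc i | toℕ-csucc (csucc i)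
... | inj₁ a       | inj₁ c       = m≢1+n+m (toℕ i) {1} (sym (trans (cong suc (sym a)) (trans (sym c) (cong toℕ eq))))
... | inj₁ a       | inj₂ (c , d) = <⇒≢ 2≤m (trans (cong suc (trans (sym c) (cong toℕ eq))) (trans (sym a) d))
... | inj₂ (a , b) | inj₁ c       = <⇒≢ 2≤m (trans (cong suc (sym a)) (trans (sym c) (trans (cong toℕ eq) b)))
... | inj₂ (a , b) | inj₂ (c , d) = <⇒≢ (≤-trans (s≤s z≤n) 2≤m) (trans (sym a) d)

module _ {V : Set} where

  Side : ∀ {p} → (Fin p → V) → V → V → Set
  Side b u v = ∃[ i ] ((b i ≡ u × b (csucc i) ≡ v) ⊎ (b i ≡ v × b (csucc i) ≡ u))

  Side-sym : ∀ {p} {b : Fin p → V} {u v} → Side b u v → Side b v u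
  Side-sym (i , inj₁ e) = i , inj₂ e
  Side-sym (i , inj₂ e) = i , inj₁ e

  -- By injectivity `v` has a single index, so a neighbour is its successor or its predecessor, and
  -- two distinct neighbours are one of each.
  two-neighbours : ∀ {p} {b : Fin p → V} → Injective _≡_ _≡_ b → ∀ {v x y z} →
                   Side b v x → Side b v y → Side b v z → x ≢ y → z ≡ x ⊎ z ≡ y
  two-neighbours {b = b} inj = cases
    where
    same-next : ∀ {i j v x y} → b i ≡ v × b (csucc i) ≡ x → b j ≡ v × b (csucc j) ≡ y → x ≡ y
    same-next (p , q) (r , s) = trans (sym q) (trans (cong (b ∘ csucc) (inj (trans p (sym r)))) s)

    same-previous : ∀ {i j v x y} → b i ≡ x × b (csucc i) ≡ v → b j ≡ y × b (csucc j) ≡ v → x ≡ y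
    same-previous (p , q) (r , s) = trans (sym p) (trans (cong b (csucc-injective (inj (trans q (sym s))))) r)

    cases : ∀ {v x y z} → Side b v x → Side b v y → Side b v z → x ≢ y → z ≡ x ⊎ z ≡ y
    cases (_ , inj₁ e) (_ , inj₁ f) _            x≢y = contradiction (same-next e f) x≢y
    cases (_ , inj₂ e) (_ , inj₂ f) _            x≢y = contradiction (same-previous e f) x≢y
    cases (_ , inj₁ e) (_ , inj₂ f) (_ , inj₁ g) _   = inj₁ (same-next g e)
    cases (_ , inj₁ e) (_ , inj₂ f) (_ , inj₂ g) _   = inj₂ (same-previous g f)
    cases (_ , inj₂ e) (_ , inj₁ f) (_ , inj₁ g) _   = inj₂ (same-next g f)
    cases (_ , inj₂ e) (_ , inj₁ f) (_ , inj₂ g) _   = inj₁ (same-previous g e)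

  triangle : ∀ {p} {b : Fin p → V} → p ≡ 3 → Injective _≡_ _≡_ b → ∀ {v u} → Side b v u →
             ∃[ w ] (Side b v w × Side b u w × w ≢ u × w ≢ v × u ≢ v)
  triangle {b = b} refl inj = λ where
      (i , inj₁ (refl , refl)) → third i
      (i , inj₂ (refl , refl)) → let (w , vw , uw , w≢u , w≢v , u≢v) = third i in w , uw , vw , w≢v , w≢u , u≢v ∘ sym
    where
    csucc³ : ∀ i → csucc (csucc (csucc {3} i)) ≡ i
    csucc³ Fin.zero                     = refl
    csucc³ (Fin.suc Fin.zero)           = refl
    csucc³ (Fin.suc (Fin.suc Fin.zero)) = refl

    third : ∀ i → ∃[ w ] (Side b (b i) w × Side b (b (csucc i)) w × w ≢ b (csucc i) × w ≢ b i × b (csucc i) ≢ b i)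
    third i = b (csucc (csucc i)) ,
      (csucc (csucc i) , inj₂ (refl , cong b (csucc³ i))) , (csucc i , inj₁ (refl , refl)) ,
      csucc-≢ (s≤s (s≤s z≤n)) (csucc i) ∘ inj , csucc²-≢ ≤-refl i ∘ inj , csucc-≢ (s≤s (s≤s z≤n)) i ∘ inj

  -- The two inequalities say that the two neighbours of each corner differ, which is what turning a
  -- flag at that corner needs.
  square : ∀ {p} {b : Fin p → V} → p ≡ 4 → Injective _≡_ _≡_ b → ∀ {v u} → Side b v u →
           ∃[ w ] ∃[ x ] (Side b v w × Side b w x × Side b u x × w ≢ u × x ≢ v)
  square {b = b} refl inj = λ where
      (i , inj₁ (refl , refl)) → opposite i
      (i , inj₂ (refl , refl)) → let (w , x , vw , wx , ux , w≢u , x≢v) = opposite i in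
        x , w , ux , Side-sym wx , vw , x≢v , w≢u
    where
    csucc⁴ : ∀ i → csucc (csucc (csucc (csucc {4} i))) ≡ i
    csucc⁴ Fin.zero                               = refl
    csucc⁴ (Fin.suc Fin.zero)                     = refl
    csucc⁴ (Fin.suc (Fin.suc Fin.zero))           = refl
    csucc⁴ (Fin.suc (Fin.suc (Fin.suc Fin.zero))) = refl

    opposite : ∀ i → ∃[ w ] ∃[ x ] (Side b (b i) w × Side b w x × Side b (b (csucc i)) x × w ≢ b (csucc i) × x ≢ b i)
    opposite i = b (csucc (csucc (csucc i))) , b (csucc (csucc i)) ,
      (csucc (csucc (csucc i)) , inj₂ (refl , cong b (csucc⁴ i))) , (csucc (csucc i) , inj₂ (refl , refl)) ,
      (csucc i , inj₁ (refl , refl)) , csucc²-≢ (m≤m+n 3 1) (csucc i) ∘ inj , csucc²-≢ (m≤m+n 3 1) i ∘ inj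

-- Consistency of the labels along an edge

open DecMembership (×-≡-dec _≟ₗ_ _≟ₗ_) using () renaming (_∈?_ to _∈ₚ?_)

first : Label → ℕ
first []      = 0
first (p ∷ _) = p

-- The head of a label is the size of the flag's own face, the last entry that of the face across
-- the edge. Both ends of an edge see the same two faces.
Compatible : Label × Label → Set
Compatible (ℓ , m) = first ℓ ≡ first m × first (reverse ℓ) ≡ first (reverse m)

-- n is the label at the remaining vertex of the triangle; n and o are those at the remaining vertices
-- of the square, next to the vertices labelled ℓ and m respectively.
TriangleCloses SquareCloses Turns : List (Label × Label) → Label × Label → Set
TriangleCloses E (ℓ , m) = Any (λ (a , n) → a ≡ turn ℓ × (turn m , turn n) ∈ E) E
SquareCloses E (ℓ , m) =
  Any (λ (a , n) → a ≡ turn ℓ × Any (λ (b , o) → b ≡ turn m × (turn n , turn o) ∈ E) E) E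
Turns E (ℓ , _) = Any (λ (a , _) → a ≡ turn ℓ) E

-- In order: the edge seen from its other end, from its other side, around a triangle or square, and
-- the other edge of the face at the vertex labelled `ℓ`.
Extends : List (Label × Label) → Label × Label → Set
Extends E (ℓ , m) =
  (m , ℓ) ∈ E × (reverse ℓ , reverse m) ∈ E ×
  (first ℓ ≡ 3 → TriangleCloses E (ℓ , m)) × (first ℓ ≡ 4 → SquareCloses E (ℓ , m)) × Turns E (ℓ , m)

compatible? : Decidable Compatible
compatible? (ℓ , m) = (first ℓ ≟ first m) ×-dec (first (reverse ℓ) ≟ first (reverse m))

extends? : ∀ E → Decidable (Extends E)
extends? E (ℓ , m) =
  ((m , ℓ) ∈ₚ? E) ×-dec ((reverse ℓ , reverse m) ∈ₚ? E) ×-dec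
  ((first ℓ ≟ 3) →-dec Any.any? (λ (a , n) → (a ≟ₗ turn ℓ) ×-dec ((turn m , turn n) ∈ₚ? E)) E) ×-dec
  ((first ℓ ≟ 4) →-dec Any.any? (λ (a , n) → (a ≟ₗ turn ℓ) ×-dec
    Any.any? (λ (b , o) → (b ≟ₗ turn m) ×-dec ((turn n , turn o) ∈ₚ? E)) E) E) ×-dec
  Any.any? (λ (a , _) → a ≟ₗ turn ℓ) E

candidates : List Label → List (Label × Label)
candidates S = filter compatible? (cartesianProduct S S)

refine : List (Label × Label) → List (Label × Label)
refine E = filter (extends? E) E

-- Elimination of pairs of types by finite search

Separated : List Label → List Label → List (Label × Label) → Set
Separated S T = All (λ (ℓ , m) → ¬ (ℓ ∈ S × m ∈ T))

separated? : ∀ S T → Decidable (Separated S T)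
separated? S T = All.all? (λ (ℓ , m) → ¬? ((ℓ ∈? S) ×-dec (m ∈? T)))

data SeparatedWithin (S T : List Label) : ℕ → List (Label × Label) → Set where
  now   : ∀ {n E} → Separated S T E → SeparatedWithin S T n E
  later : ∀ {n E} → SeparatedWithin S T n (refine E) → SeparatedWithin S T (suc n) E

separatedWithin? : ∀ S T n → Decidable (SeparatedWithin S T n)
separatedWithin? S T zero    E = map′ now (λ where (now sep) → sep) (separated? S T E)
separatedWithin? S T (suc n) E = map′ [ now , later ]′ (λ where (now sep) → inj₁ sep ; (later sep) → inj₂ sep)
  (separated? S T E ⊎-dec separatedWithin? S T n (refine E))

Allowed : Label → Label → Set
Allowed c d = Any (λ (a , b) → (c ≡ a × d ≡ b) ⊎ (c ≡ b × d ≡ a)) allowedTypes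

Resolved : Label → Label → Set
Resolved c d = c ≡ d ⊎ Allowed c d ⊎ SeparatedWithin (orbit c) (orbit d) 6 (candidates (orbit c ++ orbit d))

resolved? : ∀ c d → Dec (Resolved c d)
resolved? c d = (c ≟ₗ d) ⊎-dec
  Any.any? (λ (a , b) → ((c ≟ₗ a) ×-dec (d ≟ₗ b)) ⊎-dec ((c ≟ₗ b) ×-dec (d ≟ₗ a))) allowedTypes ⊎-dec
  separatedWithin? (orbit c) (orbit d) 6 (candidates (orbit c ++ orbit d))

-- This evaluation over all ordered pairs of types is the case analysis of the theorem. At most six
-- rounds of refinement suffice for every pair that is neither equal nor listed.
all-resolved : All (λ c → All (Resolved c) types) types
all-resolved = from-yes (All.all? (λ c → All.all? (resolved? c) types) types)

orbits-dihedral : All (Dihedral ∘ orbit) types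
orbits-dihedral = All.map (λ closed → record
  { turn-closed    = λ h → proj₁ (All.lookup closed h)
  ; reverse-closed = λ h → proj₂ (All.lookup closed h)
  }) (from-yes (All.all? (λ c → All.all? (λ ℓ → (turn ℓ ∈? orbit c) ×-dec (reverse ℓ ∈? orbit c)) (orbit c)) types))

-- `Rot` ranges over all natural offsets, which cannot be searched; offsets below 6 suffice because
-- no type is longer.
≈ᶜ-within? : ∀ s t → Dec (Any (λ i → t ≡ drop i s ++ take i s) (upTo 6) ⊎
                         Any (λ i → t ≡ drop i (reverse s) ++ take i (reverse s)) (upTo 6))
≈ᶜ-within? s t = Any.any? (λ i → t ≟ₗ (drop i s ++ take i s)) _ ⊎-dec
                 Any.any? (λ i → t ≟ₗ (drop i (reverse s) ++ take i (reverse s))) _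

orbits-≈ᶜ : All (λ c → All (λ s → All (s ≈ᶜ_) (orbit c)) (orbit c)) types
orbits-≈ᶜ = All.map (All.map (All.map [ inj₁ ∘ Any.satisfied , inj₂ ∘ Any.satisfied ]′))
  (from-yes (All.all? (λ c → All.all? (λ s → All.all? (≈ᶜ-within? s) (orbit c)) (orbit c)) types))

orbits-centre : All (λ c → c ∈ orbit c) types
orbits-centre = from-yes (All.all? (λ c → c ∈? orbit c) types)

-- Reading the faces around a vertex

Unique-resp-↭ : ∀ {A : Set} {xs ys : List A} → xs ↭ ys → Unique xs → Unique ys
Unique-resp-↭ {A} p = Permutationₛ.Unique-resp-↭ (setoid A) (↭⇒↭ₛ p)

module Local (M : PreMap) (isMap : IsMap M) where
  open PreMap M
  open IsMap isMap

  -- Walk v u fs w: the faces fs are crossed one after the other around v, from the edge vu to the edge vw.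
  data Walk (v : Fin nV) : Fin nV → List (Fin nF) → Fin nV → Set where
    []   : ∀ {u} → Walk v u [] u
    pass : ∀ {u x w f fs} → EdgeIn M f v u → EdgeIn M f v x → u ≢ x → Walk v x fs w → Walk v u (f ∷ fs) w

  _++ʷ_ : ∀ {v u x w fs gs} → Walk v u fs x → Walk v x gs w → Walk v u (fs ++ gs) w
  []             ++ʷ q = q
  pass e e′ ne p ++ʷ q = pass e e′ ne (p ++ʷ q)

  splitʷ : ∀ {v u w} fs {gs} → Walk v u (fs ++ gs) w → ∃[ x ] (Walk v u fs x × Walk v x gs w)
  splitʷ []       p                = _ , [] , p
  splitʷ (f ∷ fs) (pass e e′ ne p) = let (x , q , r) = splitʷ fs p in x , pass e e′ ne q , r

  reverseʷ : ∀ {v u w fs} → Walk v u fs w → Walk v w (reverse fs) u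
  reverseʷ []                             = []
  reverseʷ {fs = f ∷ fs} (pass e e′ ne p) =
    subst (λ gs → Walk _ _ gs _) (sym (unfold-reverse f fs)) (reverseʷ p ++ʷ pass e′ e (ne ∘ sym) [])

  tabulateʷ : ∀ {v} n (ρ : Fin (suc n) → Fin nF) (U : Fin (suc n) → Fin nV) {u} →
              EdgeIn M (ρ Fin.zero) v u → u ≢ U Fin.zero → (∀ j → EdgeIn M (ρ j) v (U j)) →
              (∀ j → EdgeIn M (ρ (Fin.suc j)) v (U (inject₁ j))) → (∀ j → U (inject₁ j) ≢ U (Fin.suc j)) →
              Walk v u (tabulate ρ) (U (fromℕ n))
  tabulateʷ zero    ρ U e ne exits entries nes = pass e (exits Fin.zero) ne []
  tabulateʷ (suc n) ρ U e ne exits entries nes = pass e (exits Fin.zero) ne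
    (tabulateʷ n (ρ ∘ Fin.suc) (U ∘ Fin.suc) (entries Fin.zero) (nes Fin.zero) (exits ∘ Fin.suc)
      (entries ∘ Fin.suc) (nes ∘ Fin.suc))

  -- By `edge-2` an edge on `f` lies on just one other face.
  opposite-unique : ∀ {f g h u v} → EdgeIn M f u v → EdgeIn M g u v → EdgeIn M h u v → g ≢ f → h ≢ f → g ≡ h
  opposite-unique {f} {g} {h} ef eg eh g≢f h≢f with edge-2 f _ _ ef
  ... | _ , _ , _ , only with only g eg | only h eh
  ...   | inj₁ g≡f | _        = contradiction g≡f g≢f
  ...   | _        | inj₁ h≡f = contradiction h≡f h≢f
  ...   | inj₂ g≡k | inj₂ h≡k = trans g≡k (sym h≡k)

  FaceCycle⇒Walk : ∀ {v} (c : FaceCycle M v) → ∃[ u ] Walk v u (tabulate (FaceCycle.ρ c)) u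
  FaceCycle⇒Walk {v} record { k = suc n ; k≥3 = k≥3 ; ρ = ρ ; ρ-inj = ρ-inj ; ρ-adj = ρ-adj } =
    -- The walk starts and ends at the edge shared by the last face and the first.
    U (fromℕ n) , tabulateʷ n ρ U
      (subst (λ j → EdgeIn M (ρ j) v (U (fromℕ n))) (csucc-fromℕ n) (entry (fromℕ n)))
      (subst (λ j → U (fromℕ n) ≢ U j) (csucc-fromℕ n) (U-≢ (fromℕ n)))
      exit
      (λ j → subst (λ i → EdgeIn M (ρ i) v (U (inject₁ j))) (csucc-inject₁ j) (entry (inject₁ j)))
      (λ j → subst (λ i → U (inject₁ j) ≢ U i) (csucc-inject₁ j) (U-≢ (inject₁ j)))
    where
    U : Fin (suc n) → Fin nV
    U j = proj₁ (ρ-adj j)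

    exit : ∀ j → EdgeIn M (ρ j) v (U j)
    exit j = proj₁ (proj₂ (ρ-adj j))

    entry : ∀ j → EdgeIn M (ρ (csucc j)) v (U j)
    entry j = proj₂ (proj₂ (ρ-adj j))

    -- Otherwise three distinct faces would share the edge from v to U j.
    U-≢ : ∀ j → U j ≢ U (csucc j)
    U-≢ j eq = csucc-≢ (≤-trans (n≤1+n 2) k≥3) (csucc j) (ρ-inj (opposite-unique (exit j)
      (subst (EdgeIn M (ρ (csucc (csucc j))) v) (sym eq) (entry (csucc j))) (entry j)
      (csucc²-≢ k≥3 j ∘ ρ-inj) (csucc-≢ (≤-trans (n≤1+n 2) k≥3) j ∘ ρ-inj)))

  -- The flag (v, vu, f) together with its label. `more` ensures that the last face, the one across
  -- `vu`, differs from `f`.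
  record Reading (v u : Fin nV) (f : Fin nF) (ℓ : Label) : Set where
    constructor reading
    field
      {faces} : List (Fin nF)
      walk    : Walk v u (f ∷ faces) u
      unique  : Unique (f ∷ faces)
      more    : faces ≢ []
      sizes≡  : ℓ ≡ map len (f ∷ faces)

  Reading⇒EdgeIn : ∀ {v u f ℓ} → Reading v u f ℓ → EdgeIn M f v u
  Reading⇒EdgeIn (reading (pass e _ _ _) _ _ _) = e

  Reading⇒first : ∀ {v u f ℓ} → Reading v u f ℓ → first ℓ ≡ len f
  Reading⇒first (reading _ _ _ refl) = refl

  turn-Reading : ∀ {v u f ℓ} → Reading v u f ℓ → ∃[ w ] (EdgeIn M f v w × u ≢ w × Reading v w f (turn ℓ))
  turn-Reading (reading {fs} (pass e e′ ne p) uniq more refl) = _ , e′ , ne , record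
    { walk   = pass e′ e (ne ∘ sym) (reverseʷ p)
    ; unique = Unique-resp-↭ (prep _ (↭-sym (↭-reverse fs))) uniq
    ; more   = more ∘ reverse-injective
    ; sizes≡ = cong (_ ∷_) (sym (reverse-map len fs))
    }

  turn-Reading-at : ∀ {v u w f ℓ} → EdgeIn M f v w → w ≢ u → Reading v u f ℓ → Reading v w f (turn ℓ)
  turn-Reading-at {f = f} e w≢u r with turn-Reading r
  ... | x , e′ , u≢x , r′ with two-neighbours (bd-inj f) (Reading⇒EdgeIn r) e′ e u≢x
  ...   | inj₁ w≡u  = contradiction w≡u w≢u
  ...   | inj₂ refl = r′

  -- The closed walk read backwards begins with the face across `vu`.
  reverse-Reading : ∀ {v u f ℓ} → Reading v u f ℓ → ∃[ g ] (g ≢ f × Reading v u g (reverse ℓ))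
  reverse-Reading {v} {u} {f} (reading {fs} p uniq@(f∉fs ∷ _) more refl) with reverse fs in eq
  ... | []     = contradiction (reverse-injective {x = fs} {y = []} eq) more
  ... | g ∷ gs = g , (λ g≡f → All.lookup f∉fs g∈fs (sym g≡f)) , record
    { walk   = subst (λ hs → Walk v u hs u) rev (reverseʷ p)
    ; unique = subst Unique rev (Unique-resp-↭ (↭-sym (↭-reverse (f ∷ fs))) uniq)
    ; more   = λ e → case trans (sym (cong length e)) (length-∷ʳ gs) of λ ()
    ; sizes≡ = trans (sym (reverse-map len (f ∷ fs))) (cong (map len) rev)
    }
    where
    g∈fs : g ∈ fs
    g∈fs = ∈-resp-↭ (↭-reverse fs) (subst (g ∈_) (sym eq) (here refl))

    rev : reverse (f ∷ fs) ≡ g ∷ (gs ∷ʳ f)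
    rev = trans (unfold-reverse f fs) (cong (_∷ʳ f) eq)

    length-∷ʳ : ∀ hs → length (hs ∷ʳ f) ≡ suc (length hs)
    length-∷ʳ []       = refl
    length-∷ʳ (_ ∷ hs) = cong suc (length-∷ʳ hs)

  HasType : List Label → Fin nV → Set
  HasType S v = Σ (FaceCycle M v) λ c → seqOf M c ∈ S

  -- Cutting the face cycle at `f` gives a reading from one of the two edges of `f` at `v`; if that
  -- edge is not `vu`, a turn repairs it. Rotation and turning keep the label in `S`.
  HasType⇒Reading : ∀ {S v u f} → Dihedral S → HasType S v → EdgeIn M f v u → ∃[ ℓ ] (Reading v u f ℓ × ℓ ∈ S)
  HasType⇒Reading {S} {v} {u} {f} dihedral (c , seq∈S) e = at-u
    where
    open FaceCycle c

    seq : seqOf M c ≡ map len (tabulate ρ)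
    seq = trans (map-tabulate id (len ∘ ρ)) (sym (map-tabulate ρ len))

    f∈ρ : f ∈ tabulate ρ
    f∈ρ = let (j , eq) = ρ-all f (onFace e) in subst (_∈ tabulate ρ) eq (∈-tabulate⁺ j)
      where
      onFace : EdgeIn M f v u → OnFace M f v
      onFace (i , inj₁ (p , _)) = i , p
      onFace (i , inj₂ (_ , p)) = csucc i , p

    somewhere : ∃[ w ] ∃[ ℓ ] (Reading v w f ℓ × ℓ ∈ S)
    somewhere with ∈-∃++ f∈ρ | FaceCycle⇒Walk c
    ... | fs , gs , eq | _ , p with splitʷ fs (subst (λ hs → Walk v _ hs _) eq p)
    ... | w , q , r = w , map len (f ∷ gs ++ fs) , record
      { walk   = r ++ʷ q
      ; unique = Unique-resp-↭ (++-comm fs (f ∷ gs)) (subst Unique eq (Unique.tabulate⁺ ρ-inj))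
      ; more   = λ none → <⇒≢ (≤-trans (n≤1+n 2) k≥3) (sym (trans (sym (length-tabulate ρ)) (trans (cong length eq)
                   (trans (↭-length (++-comm fs (f ∷ gs))) (cong (suc ∘ length) none)))))
      ; sizes≡ = refl
      } , subst (_∈ S) (sym (map-++ len (f ∷ gs) fs)) (rotate-closed dihedral (map len fs) (map len (f ∷ gs))
            (subst (_∈ S) (trans seq (trans (cong (map len) eq) (map-++ len fs (f ∷ gs)))) seq∈S))

    at-u : ∃[ ℓ ] (Reading v u f ℓ × ℓ ∈ S)
    at-u with somewhere
    ... | w , ℓ , r , ℓ∈S with u Fin.≟ w
    ...   | yes refl = ℓ , r , ℓ∈S
    ...   | no  u≢w  = turn ℓ , turn-Reading-at e u≢w r , turn-closed dihedral ℓ∈S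

  -- The invariant of refinement: no pair realised in the map has been discarded.
  Complete : List Label → List (Label × Label) → Set
  Complete S E = ∀ {v u f ℓ m} → Reading v u f ℓ → ℓ ∈ S → Reading u v f m → m ∈ S → (ℓ , m) ∈ E

  candidates-complete : ∀ S → Complete S (candidates S)
  candidates-complete _ {ℓ = ℓ} {m} r ℓ∈S r′ m∈S = ∈-filter⁺ compatible? (∈-cartesianProduct⁺ ℓ∈S m∈S)
    (trans (Reading⇒first r) (sym (Reading⇒first r′)) , across)
    where
    across : first (reverse ℓ) ≡ first (reverse m)
    across with reverse-Reading r | reverse-Reading r′
    ... | g , g≢f , s | h , h≢f , s′ = trans (Reading⇒first s) (trans
      (cong len (opposite-unique (Reading⇒EdgeIn r) (Reading⇒EdgeIn s) (Side-sym (Reading⇒EdgeIn s′)) g≢f h≢f))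
      (sym (Reading⇒first s′)))

  -- The neighbouring flags asked for by `Extends` exist in the map, and by the invariant their
  -- pairs are still in `E`.
  refine-complete : ∀ {S} → Dihedral S → (∀ v → HasType S v) → ∀ {E} → Complete S E → Complete S (refine E)
  refine-complete dihedral typed {E} complete {v} {u} {f} {ℓ} {m} r ℓ∈S r′ m∈S =
    ∈-filter⁺ (extends? E) (complete r ℓ∈S r′ m∈S)
      (complete r′ m∈S r ℓ∈S , reversed , closes-triangle , closes-square , turns)
    where
    reversed : (reverse ℓ , reverse m) ∈ E
    reversed with reverse-Reading r | reverse-Reading r′
    -- Both ends see the same second face of the edge, so `s` and `s′` read the same side.
    ... | g , g≢f , s | h , h≢f , s′ = complete s (reverse-closed dihedral ℓ∈S)
      (subst (λ k → Reading u v k (reverse m)) (sym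
        (opposite-unique (Reading⇒EdgeIn r) (Reading⇒EdgeIn s) (Side-sym (Reading⇒EdgeIn s′)) g≢f h≢f)) s′)
      (reverse-closed dihedral m∈S)

    turns : Turns E (ℓ , m)
    turns with turn-Reading r
    ... | w , e , _ , s with HasType⇒Reading dihedral (typed w) (Side-sym e)
    ... | n , t , n∈S = lose (complete s (turn-closed dihedral ℓ∈S) t n∈S) refl

    closes-triangle : first ℓ ≡ 3 → TriangleCloses E (ℓ , m)
    closes-triangle ℓ≡3 with triangle (trans (sym (Reading⇒first r)) ℓ≡3) (bd-inj f) (Reading⇒EdgeIn r)
    ... | w , vw , uw , w≢u , w≢v , u≢v with HasType⇒Reading dihedral (typed w) (Side-sym vw)
    ... | n , t , n∈S = lose
      (complete (turn-Reading-at vw w≢u r) (turn-closed dihedral ℓ∈S) t n∈S)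
      (refl , complete (turn-Reading-at uw w≢v r′) (turn-closed dihedral m∈S)
                       (turn-Reading-at (Side-sym uw) u≢v t) (turn-closed dihedral n∈S))

    closes-square : first ℓ ≡ 4 → SquareCloses E (ℓ , m)
    closes-square ℓ≡4 with square (trans (sym (Reading⇒first r)) ℓ≡4) (bd-inj f) (Reading⇒EdgeIn r)
    ... | w , x , vw , wx , ux , w≢u , x≢v
      with HasType⇒Reading dihedral (typed w) (Side-sym vw) | HasType⇒Reading dihedral (typed x) (Side-sym ux)
    ... | n , t , n∈S | o , t′ , o∈S = lose
      (complete (turn-Reading-at vw w≢u r) (turn-closed dihedral ℓ∈S) t n∈S)
      (refl , lose
        (complete (turn-Reading-at ux x≢v r′) (turn-closed dihedral m∈S) t′ o∈S)
        (refl , complete (turn-Reading-at wx x≢v t) (turn-closed dihedral n∈S)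
                         (turn-Reading-at (Side-sym wx) w≢u t′) (turn-closed dihedral o∈S)))

  -- Edges joining the two types

  Contact : (Fin nV → Set) → (Fin nV → Set) → Set
  Contact P Q = ∃[ u ] ∃[ v ] (IsEdge M u v × P u × Q v)

  -- A discrete intermediate value argument, run backwards from the end of the path.
  contact : ∀ {P Q : Fin nV → Set} → (∀ v → P v ⊎ Q v) → ∀ {u v} → Reach M u v → P u → Q v → Contact P Q
  -- `P` and `Q` may overlap. A vertex with both properties forms a contact with any neighbour,
  -- whichever property that neighbour has.
  contact {P} {Q} either {u} here p q = meeting (link u)
    where
    meeting : FaceCycle M u → Contact P Q
    meeting record { k = suc _ ; ρ = ρ ; ρ-adj = ρ-adj } with ρ-adj Fin.zero
    ... | w , e , _ with either w
    ...   | inj₁ p′ = w , u , (ρ Fin.zero , Side-sym e) , p′ , q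
    ...   | inj₂ q′ = u , w , (ρ Fin.zero , e) , p , q′
  contact either (step {v} r e) p q with either v
  ... | inj₁ p′ = v , _ , e , p′ , q
  ... | inj₂ q′ = contact either r p q′

  module _ {S T : List Label} (dS : Dihedral S) (dT : Dihedral T) (either : ∀ v → HasType S v ⊎ HasType T v) where

    typed : ∀ v → HasType (S ++ T) v
    typed v = [ (λ (c , h) → c , ∈-++⁺ˡ h) , (λ (c , h) → c , ∈-++⁺ʳ S h) ]′ (either v)

    Separated⇒¬Contact : ∀ {E} → Complete (S ++ T) E → Separated S T E → ¬ Contact (HasType S) (HasType T)
    Separated⇒¬Contact complete sep (u , v , (f , e) , hS , hT)
      with HasType⇒Reading dS hS e | HasType⇒Reading dT hT (Side-sym e)
    ... | ℓ , r , ℓ∈S | m , r′ , m∈T = All.lookup sep (complete r (∈-++⁺ˡ ℓ∈S) r′ (∈-++⁺ʳ S m∈T)) (ℓ∈S , m∈T)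

    SeparatedWithin⇒¬Contact : ∀ {n E} → Complete (S ++ T) E → SeparatedWithin S T n E →
                               ¬ Contact (HasType S) (HasType T)
    SeparatedWithin⇒¬Contact complete (now sep)   = Separated⇒¬Contact complete sep
    SeparatedWithin⇒¬Contact complete (later sep) =
      SeparatedWithin⇒¬Contact (refine-complete (Dihedral-++ dS dT) typed complete) sep

  -- From the types of the map to the finite search

  seqOf≥3 : ∀ {v} (c : FaceCycle M v) → All (3 ≤_) (seqOf M c)
  seqOf≥3 c = All.tabulate λ h → let (j , _ , eq) = ∈-map⁻ _ h in subst (3 ≤_) (sym eq) (len≥3 _)

  length-seqOf : ∀ {v} (c : FaceCycle M v) → length (seqOf M c) ≡ FaceCycle.k c
  length-seqOf c = trans (length-map _ (allFin (FaceCycle.k c))) (length-tabulate id)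

  FSis⇒orbit : CurvatureZero M → ∀ {v s} → FSis M v s → ∃[ c ] (c ∈ types × s ∈ orbit c)
  FSis⇒orbit curv {v} (t , (cyc , refl) , t≈s) with find (Flat⇒Typed (seqOf≥3 cyc)
    (subst (3 ≤_) (sym (length-seqOf cyc)) (FaceCycle.k≥3 cyc))
    (curvature≡0⇒Flat (seqOf≥3 cyc) (curv v t (cyc , refl))))
  ... | c , c∈types , t∈c = c , c∈types , ≈ᶜ-closed (All.lookup orbits-dihedral c∈types) t≈s t∈c

  FSis⇒HasType : ∀ {S s v} → Dihedral S → s ∈ S → FSis M v s → HasType S v
  FSis⇒HasType dS s∈S (t , (c , refl) , t≈s) = c , ≈ᶜ-closed⁻ dS t≈s s∈S

theorem1p1 : (M : PreMap) → IsMap M → EulerZero M → CurvatureZero M →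
    (f₁ f₂ : List ℕ) → TwoSemiEquivelar M f₁ f₂ → TypeAllowed f₁ f₂
theorem1p1 M isMap _ curv f₁ f₂ (f₁≉f₂ , (v₁ , h₁) , (v₂ , h₂) , either) =
  conclude (FSis⇒orbit curv h₁) (FSis⇒orbit curv h₂)
  where
  open Local M isMap

  conclude : ∃[ c ] (c ∈ types × f₁ ∈ orbit c) → ∃[ d ] (d ∈ types × f₂ ∈ orbit d) → TypeAllowed f₁ f₂
  conclude (c , c∈ , f₁∈) (d , d∈ , f₂∈) = resolve (All.lookup (All.lookup all-resolved c∈) d∈)
    where
    dc = All.lookup orbits-dihedral c∈
    dd = All.lookup orbits-dihedral d∈

    has-type : ∀ v → HasType (orbit c) v ⊎ HasType (orbit d) v
    has-type v = [ inj₁ ∘ FSis⇒HasType dc f₁∈ , inj₂ ∘ FSis⇒HasType dd f₂∈ ]′ (either v)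

    f₁≈c : f₁ ≈ᶜ c
    f₁≈c = All.lookup (All.lookup (All.lookup orbits-≈ᶜ c∈) f₁∈) (All.lookup orbits-centre c∈)

    f₂≈d : f₂ ≈ᶜ d
    f₂≈d = All.lookup (All.lookup (All.lookup orbits-≈ᶜ d∈) f₂∈) (All.lookup orbits-centre d∈)

    resolve : Resolved c d → TypeAllowed f₁ f₂
    -- Two members of one orbit are equivalent, whereas `f₁` and `f₂` are not.
    resolve (inj₁ refl) = contradiction (All.lookup (All.lookup (All.lookup orbits-≈ᶜ c∈) f₁∈) f₂∈) f₁≉f₂
    resolve (inj₂ (inj₁ allowed)) = Any.map (λ where
      (inj₁ (refl , refl)) → inj₁ (f₁≈c , f₂≈d)
      (inj₂ (refl , refl)) → inj₂ (f₁≈c , f₂≈d)) allowed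
    -- Connectedness yields an edge between the two types, which the refined list rules out.
    resolve (inj₂ (inj₂ sep)) = contradiction
      (contact has-type (IsMap.conn isMap v₁ v₂) (FSis⇒HasType dc f₁∈ h₁) (FSis⇒HasType dd f₂∈ h₂))
      (SeparatedWithin⇒¬Contact dc dd has-type (candidates-complete (orbit c ++ orbit d)) sep)
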